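{- For all positive integers $s,k$ and every integer $n\geq 3$, the graph $sF_{n+1}\cup kF_n$ (the disjoint union of $s$ copies of $F_{n+1}$ and $k$ copies of $F_n$) is $C_3$-supermagic.
   Context: All graphs are finite and simple. For a graph $H$, a graph $G=(V,E)$ has an $H$-covering if every edge of $G$ belongs to a subgraph of $G$ isomorphic to $H$. For such $G$, an $H$-magic labeling is a bijection $\lambda: V\cup E\to\{1,2,\dots,|V|+|E|\}$ for which there is a constant $c$ such that for every subgraph $H'=(V',E')$ of $G$ isomorphic to $H$, $\sum_{v\in V'}\lambda(v)+\sum_{e\in E'}\lambda(e)=c$. It is $H$-supermagic if moreover $\{\lambda(v):v\in V\}=\{1,\dots,|V|\}$; $G$ is $H$-supermagic if it admits such a labeling. $C_k$ is the cycle of length $k$. $sG$ denotes the disjoint union of $s$ copies of $G$, and $\cup$ denotes disjoint union. For $n\geq 3$, the fan $F_n=K_1+P_n$ has vertices $c,v_1,\dots,v_n$ and edges $cv_i$ ($1\le i\le n$) and $v_iv_{i+1}$ ($1\le i\le n-1$). -}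

module Defs where

open import Data.Bool using (Bool; T; if_then_else_)
open import Data.Bool.Properties using (T-irrelevant)
open import Data.Empty using (⊥-elim)
open import Data.Fin using (Fin; zero; suc; inject₁; fromℕ; toℕ)
open import Data.Fin.Properties
  using (1↔⊤; +↔⊎; *↔×; suc-injective; toℕ-inject₁)
open import Data.Nat using (ℕ; zero; suc; pred; _+_; _≤_; z≤n; s≤s)
open import Data.Nat.Properties using (+-0-commutativeMonoid; 1+n≢n; m≢1+n+m)
open import Data.Product using (Σ; ∃; _×_; _,_; proj₁; proj₂; swap; map)
open import Data.Product.Function.NonDependent.Propositional using (_×-↔_)
open import Data.Product.Properties using (,-injectiveˡ; ,-injectiveʳ)
open import Data.Sum using (_⊎_; inj₁; inj₂)
open import Data.Sum.Function.Propositional using (_⊎-↔_)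
open import Data.Sum.Properties using (inj₁-injective; inj₂-injective)
open import Data.Unit using (⊤; tt)
open import Function using (_∘_)
open import Function.Bundles using (_↔_; _⤖_; _⇔_; Inverse; Bijection)
open import Function.Construct.Composition using (_↔-∘_)
open import Function.Construct.Identity using (↔-id)
open import Function.Construct.Symmetry using (↔-sym)
open import Function.Definitions using (Injective)
open import Relation.Binary.PropositionalEquality
  using (_≡_; _≢_; refl; sym; trans; cong; cong₂)

open import Algebra.Properties.CommutativeMonoid.Sum +-0-commutativeMonoid
  using (sum)

record Finite (A : Set) : Set where
  constructor finite
  field
    {size} : ℕ
    index  : A ↔ Fin size

open Finite public using (size; index)

finite-Fin : ∀ n → Finite (Fin n)
finite-Fin n = finite (↔-id (Fin n))

finite-⊤ : Finite ⊤
finite-⊤ = finite (↔-sym 1↔⊤)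

_finite-⊎_ : ∀ {A B} → Finite A → Finite B → Finite (A ⊎ B)
finite f finite-⊎ finite g = finite (↔-sym +↔⊎ ↔-∘ (f ⊎-↔ g))

_finite-×_ : ∀ {A B} → Finite A → Finite B → Finite (A × B)
finite f finite-× finite g = finite (↔-sym *↔× ↔-∘ (f ×-↔ g))

∑ : ∀ {A : Set} → Finite A → (A → Bool) → (A → ℕ) → ℕ
∑ fin S f = sum λ i → let a = Inverse.from (index fin) i in
                      if S a then f a else 0

infix 4 _≈_

_≈_ : ∀ {A : Set} → A × A → A × A → Set
p ≈ q = p ≡ q ⊎ p ≡ swap q

≈-map⁻ : ∀ {A B : Set} {f : A → B} → Injective _≡_ _≡_ f →
         ∀ {p q} → map f f p ≈ map f f q → p ≈ q
≈-map⁻ inj (inj₁ eq) =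
  inj₁ (cong₂ _,_ (inj (,-injectiveˡ eq)) (inj (,-injectiveʳ eq)))
≈-map⁻ inj (inj₂ eq) =
  inj₂ (cong₂ _,_ (inj (,-injectiveˡ eq)) (inj (,-injectiveʳ eq)))

-- An edge is determined by its two distinct ends; the order in which
-- `ends` lists them carries no meaning.
record SimpleGraph : Set₁ where
  field
    V        : Set
    E        : Set
    ends     : E → V × V
    loopless : ∀ e → proj₁ (ends e) ≢ proj₂ (ends e)
    simple   : ∀ {e e′} → ends e ≈ ends e′ → e ≡ e′

record Graph : Set₁ where
  field
    simpleGraph : SimpleGraph
  open SimpleGraph simpleGraph public
  field
    finiteV : Finite V
    finiteE : Finite E

  ∣V∣ ∣E∣ : ℕ
  ∣V∣ = size finiteV
  ∣E∣ = size finiteE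

infix 4 _≅_

record _≅_ (G H : SimpleGraph) : Set where
  private
    module G = SimpleGraph G
    module H = SimpleGraph H
  field
    V↔ : G.V ↔ H.V
    E↔ : G.E ↔ H.E
  onV = Inverse.to V↔
  onE = Inverse.to E↔
  field
    preserves-ends : ∀ e → H.ends (onE e) ≈ map onV onV (G.ends e)

record Subgraph (G : SimpleGraph) : Set where
  open SimpleGraph G
  field
    inV    : V → Bool
    inE    : E → Bool
    closed : ∀ e → T (inE e) → T (inV (proj₁ (ends e))) × T (inV (proj₂ (ends e)))

  asGraph : SimpleGraph
  asGraph = record
    { V        = Σ V (T ∘ inV)
    ; E        = Σ E (T ∘ inE)
    ; ends     = λ (e , p) → (proj₁ (ends e) , proj₁ (closed e p))
                           , (proj₂ (ends e) , proj₂ (closed e p))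
    ; loopless = λ (e , _) → loopless e ∘ cong proj₁
    ; simple   = λ eq → Σ-≡ (simple (forget eq))
    }
    where
    Σ-≡ : ∀ {a b : Σ E (T ∘ inE)} → proj₁ a ≡ proj₁ b → a ≡ b
    Σ-≡ {e , p} {_ , q} refl = cong (e ,_) (T-irrelevant p q)

    forget : {p q : Σ V (T ∘ inV) × Σ V (T ∘ inV)} →
             p ≈ q → map proj₁ proj₁ p ≈ map proj₁ proj₁ q
    forget (inj₁ eq) = inj₁ (cong (map proj₁ proj₁) eq)
    forget (inj₂ eq) = inj₂ (cong (map proj₁ proj₁) eq)

SubgraphIsoTo : Graph → Graph → Set
SubgraphIsoTo H G = Σ (Subgraph (Graph.simpleGraph G)) λ S →
                    Subgraph.asGraph S ≅ Graph.simpleGraph H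

HasCovering : Graph → Graph → Set
HasCovering H G = ∀ (e : Graph.E G) →
  Σ (SubgraphIsoTo H G) λ (S , _) → T (Subgraph.inE S e)

module _ (G : Graph) where
  open Graph G

  -- `zero : Fin _` stands for the label 1.
  Labeling : Set
  Labeling = (V ⊎ E) ⤖ Fin (∣V∣ + ∣E∣)

  module _ (ℓ : Labeling) where

    label : V ⊎ E → ℕ
    label = suc ∘ toℕ ∘ Bijection.to ℓ

    weight : Subgraph simpleGraph → ℕ
    weight S = ∑ finiteV inV (label ∘ inj₁) + ∑ finiteE inE (label ∘ inj₂)
      where open Subgraph S

    IsMagic : Graph → Set
    IsMagic H = ∃ λ c → ∀ ((S , _) : SubgraphIsoTo H G) → weight S ≡ c

    VerticesFirst : Set
    VerticesFirst = ∀ m → (∃ λ v → label (inj₁ v) ≡ m) ⇔ (1 ≤ m × m ≤ ∣V∣)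

Supermagic : Graph → Graph → Set
Supermagic H G =
  HasCovering H G × ∃ λ (ℓ : Labeling G) → IsMagic G ℓ H × VerticesFirst G ℓ

infixr 6 _∪_
infixr 7 _·_

_∪_ : Graph → Graph → Graph
G ∪ H = record
  { simpleGraph = record
    { V        = G.V ⊎ H.V
    ; E        = G.E ⊎ H.E
    ; ends     = endsᵁ
    ; loopless = λ where
        (inj₁ e) → G.loopless e ∘ inj₁-injective
        (inj₂ e) → H.loopless e ∘ inj₂-injective
    ; simple   = λ {e} {e′} → simpleᵁ e e′
    }
  ; finiteV = G.finiteV finite-⊎ H.finiteV
  ; finiteE = G.finiteE finite-⊎ H.finiteE
  }
  where
  module G = Graph G
  module H = Graph H

  endsᵁ : G.E ⊎ H.E → (G.V ⊎ H.V) × (G.V ⊎ H.V)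
  endsᵁ (inj₁ e) = map inj₁ inj₁ (G.ends e)
  endsᵁ (inj₂ e) = map inj₂ inj₂ (H.ends e)

  simpleᵁ : ∀ e e′ → endsᵁ e ≈ endsᵁ e′ → e ≡ e′
  simpleᵁ (inj₁ e) (inj₁ e′) eq = cong inj₁ (G.simple (≈-map⁻ inj₁-injective eq))
  simpleᵁ (inj₂ e) (inj₂ e′) eq = cong inj₂ (H.simple (≈-map⁻ inj₂-injective eq))
  simpleᵁ (inj₁ _) (inj₂ _) (inj₁ ())
  simpleᵁ (inj₁ _) (inj₂ _) (inj₂ ())
  simpleᵁ (inj₂ _) (inj₁ _) (inj₁ ())
  simpleᵁ (inj₂ _) (inj₁ _) (inj₂ ())

_·_ : ℕ → Graph → Graph
s · G = record
  { simpleGraph = record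
    { V        = Fin s × V
    ; E        = Fin s × E
    ; ends     = λ (i , e) → map (i ,_) (i ,_) (ends e)
    ; loopless = λ (_ , e) → loopless e ∘ cong proj₂
    ; simple   = λ {e} {e′} → simpleˢ e e′
    }
  ; finiteV = finite-Fin s finite-× finiteV
  ; finiteE = finite-Fin s finite-× finiteE
  }
  where
  open Graph G

  copy : ∀ {i j : Fin s} {p q} →
         map (i ,_) (i ,_) p ≈ map (j ,_) (j ,_) q → i ≡ j
  copy (inj₁ eq) = cong (proj₁ ∘ proj₁) eq
  copy (inj₂ eq) = cong (proj₁ ∘ proj₁) eq

  simpleˢ : ∀ ((i , e) (j , e′) : Fin s × E) →
            map (i ,_) (i ,_) (ends e) ≈ map (j ,_) (j ,_) (ends e′) →
            (i , e) ≡ (j , e′)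
  simpleˢ (i , e) (j , e′) eq with refl ← copy {p = ends e} {q = ends e′} eq =
    cong (i ,_) (simple (≈-map⁻ ,-injectiveʳ eq))

step : ∀ n → Fin (pred n) → Fin n × Fin n
step (suc n) i = inject₁ i , suc i

inject₁≢suc : ∀ {n} (i : Fin n) → inject₁ i ≢ suc i
inject₁≢suc i eq = 1+n≢n (sym (trans (sym (toℕ-inject₁ i)) (cong toℕ eq)))

step-loopless : ∀ n i → proj₁ (step n i) ≢ proj₂ (step n i)
step-loopless (suc n) = inject₁≢suc

step-simple : ∀ n {i j} → step n i ≈ step n j → i ≡ j
step-simple (suc n) (inj₁ eq) = suc-injective (,-injectiveʳ eq)
step-simple (suc n) {i} {j} (inj₂ eq) = ⊥-elim (m≢1+n+m (toℕ j) (
  trans (sym (toℕ-inject₁ j)) (trans (cong toℕ (sym (,-injectiveʳ eq)))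
    (cong suc (trans (sym (toℕ-inject₁ i)) (cong toℕ (,-injectiveˡ eq)))))))

-- The cycle on `Fin n`: the steps `i — i+1`, and the edge `tt` joining the
-- last vertex to the first.
C : ∀ n → 3 ≤ n → Graph
C n@(suc (suc (suc m))) (s≤s (s≤s (s≤s z≤n))) = record
  { simpleGraph = record
    { V        = Fin n
    ; E        = Fin (pred n) ⊎ ⊤
    ; ends     = endsᶜ
    ; loopless = λ where
        (inj₁ i) → step-loopless n i
        (inj₂ _) → λ ()
    ; simple   = λ {e} {e′} → simpleᶜ e e′
    }
  ; finiteV = finite-Fin n
  ; finiteE = finite-Fin (pred n) finite-⊎ finite-⊤
  }
  where
  endsᶜ : Fin (pred n) ⊎ ⊤ → Fin n × Fin n
  endsᶜ (inj₁ i) = step n i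
  endsᶜ (inj₂ _) = fromℕ (pred n) , zero

  not-step : ∀ (i : Fin (pred n)) → (zero , fromℕ (pred n)) ≢ step n i
  not-step zero    ()
  not-step (suc _) ()

  simpleᶜ : ∀ e e′ → endsᶜ e ≈ endsᶜ e′ → e ≡ e′
  simpleᶜ (inj₁ i) (inj₁ j) eq        = cong inj₁ (step-simple n eq)
  simpleᶜ (inj₁ i) (inj₂ _) (inj₁ ())
  simpleᶜ (inj₁ i) (inj₂ _) (inj₂ eq) = ⊥-elim (not-step i (sym eq))
  simpleᶜ (inj₂ _) (inj₁ j) (inj₁ ())
  simpleᶜ (inj₂ _) (inj₁ j) (inj₂ eq) = ⊥-elim (not-step j (cong swap eq))
  simpleᶜ (inj₂ _) (inj₂ _) _         = refl

-- `inj₁ tt` is the hub c, and `inj₂ i` is a path vertex; the edge `inj₁ i` is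
-- a spoke, and `inj₂ i` is a path edge.
F : ℕ → Graph
F n = record
  { simpleGraph = record
    { V        = ⊤ ⊎ Fin n
    ; E        = Fin n ⊎ Fin (pred n)
    ; ends     = endsᶠ
    ; loopless = λ where
        (inj₁ _) → λ ()
        (inj₂ i) → step-loopless n i ∘ inj₂-injective
    ; simple   = λ {e} {e′} → simpleᶠ e e′
    }
  ; finiteV = finite-⊤ finite-⊎ finite-Fin n
  ; finiteE = finite-Fin n finite-⊎ finite-Fin (pred n)
  }
  where
  endsᶠ : Fin n ⊎ Fin (pred n) → (⊤ ⊎ Fin n) × (⊤ ⊎ Fin n)
  endsᶠ (inj₁ i) = inj₁ tt , inj₂ i
  endsᶠ (inj₂ i) = map inj₂ inj₂ (step n i)

  simpleᶠ : ∀ e e′ → endsᶠ e ≈ endsᶠ e′ → e ≡ e′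
  simpleᶠ (inj₁ i) (inj₁ j) (inj₁ eq) = cong inj₁ (inj₂-injective (,-injectiveʳ eq))
  simpleᶠ (inj₁ i) (inj₁ j) (inj₂ ())
  simpleᶠ (inj₁ i) (inj₂ j) (inj₁ ())
  simpleᶠ (inj₁ i) (inj₂ j) (inj₂ ())
  simpleᶠ (inj₂ i) (inj₁ j) (inj₁ ())
  simpleᶠ (inj₂ i) (inj₁ j) (inj₂ ())
  simpleᶠ (inj₂ i) (inj₂ j) eq        = cong inj₂ (step-simple n (≈-map⁻ inj₂-injective eq))

{-# OPTIONS --safe #-}

-- Let the m = s + k fans be the columns j < m, the s longer ones first, and let
-- the hub be row 0 and v_i row i of its fan.  Each triangle of a fan consists of
-- the hub and two consecutive path vertices.  Vertices take the smallest labels,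
-- m · row + j counted from 0; edges take labels counted down from the largest
-- one, the i-th spoke (i = 0, 1, …) m · u i + j and the i-th path edge
-- N + m · i + j, where N is the number of spokes.  Here u is a zigzag permutation
-- of 0, …, n with u i + u (i + 1) = i + q, so that on a triangle the vertex labels
-- and the downward edge labels differ by a constant.  Since u n = n, the spokes
-- that only the longer fans have come last, and the labels leave no gap.
module Submission where

open import Data.Bool using (Bool; true; false; T; if_then_else_)
open import Data.Bool.Properties using (T-irrelevant)
open import Data.Empty using (⊥; ⊥-elim)
open import Data.Fin using (Fin; zero; suc; toℕ; fromℕ<; inject₁)
open import Data.Fin.Permutation using (reverse)
open import Data.Fin.Properties
  using (_≟_; any?; +↔⊎; punchOut-injective; injective⇒≤; fromℕ<-injective; toℕ-fromℕ<;
         toℕ-injective; toℕ<n; toℕ≤pred[n]; toℕ-inject₁; toℕ-↑ˡ; toℕ-↑ʳ; opposite-prop)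
open import Data.Nat using (ℕ; zero; suc; _+_; _*_; _∸_; _≤_; _<_; z≤n; s≤s)
open import Data.Nat.Properties hiding (_≟_)
open import Data.Nat.Tactic.RingSolver using (solve-∀)
open import Data.Product using (Σ; ∃; _×_; _,_; proj₁; proj₂; map)
open import Data.Product.Properties using (,-injectiveʳ)
open import Data.Sum using (_⊎_; inj₁; inj₂; [_,_]′)
open import Data.Sum.Function.Propositional using (_⊎-⤖_)
open import Data.Sum.Properties using (inj₁-injective; inj₂-injective)
open import Data.Unit using (⊤; tt)
open import Function using (_∘_; const)
open import Function.Bundles using (_↔_; _⤖_; mk↔ₛ′; mk⤖; mk⇔; Inverse; Bijection)
open import Function.Construct.Composition using (_↔-∘_; _⤖-∘_)
open import Function.Construct.Symmetry using (↔-sym)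
open import Function.Definitions using (Injective; Surjective)
open import Function.Properties.Inverse using (↔⇒⤖)
open import Relation.Binary.Definitions using (tri<; tri≈; tri>)
open import Relation.Binary.PropositionalEquality
open import Relation.Nullary using (Dec; yes; no; does; contradiction)
open import Relation.Nullary.Decidable using (True; isYes; toWitness; fromWitness; map′)
open import Defs

open import Algebra.Properties.CommutativeMonoid.Sum +-0-commutativeMonoid
  using (sum; sum-cong-≗; sum-replicate-zero; ∑-comm)

-- Finite sums over a decidable subset.

to-injective : ∀ {A B : Set} (f : A ↔ B) → Injective _≡_ _≡_ (Inverse.to f)
to-injective f {x} {y} eq =
  trans (sym (Inverse.strictlyInverseʳ f x))
        (trans (cong (Inverse.from f) eq) (Inverse.strictlyInverseʳ f y))

proj₁-injective : ∀ {A : Set} {P : A → Bool} → Injective _≡_ _≡_ (proj₁ {B = T ∘ P})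
proj₁-injective {x = x , p} {y = _ , q} refl = cong (x ,_) (T-irrelevant p q)

sum-δ : ∀ {n} (k : Fin n) c → sum (λ i → if does (i ≟ k) then c else 0) ≡ c
sum-δ {suc n} zero    c = trans (cong (c +_) (sum-replicate-zero n)) (+-identityʳ c)
sum-δ         (suc k) c = sum-δ k c

-- Double counting over the matrix `δ`: the row of an element of `S` has a single entry that can be
-- nonzero, all other rows vanish, and column `j` sums to the value at `x j`. In this way the weight
-- of a subgraph becomes a sum over the vertices and edges of the pattern graph.
∑-subset : ∀ {A B : Set} (finA : Finite A) (finB : Finite B) (S : A → Bool)
           (b : B ↔ Σ A (T ∘ S)) (f : A → ℕ) →
           ∑ finA S f ≡ ∑ finB (const true) (f ∘ proj₁ ∘ Inverse.to b)
∑-subset {A} (finite iA) (finite {r} iB) S b f = begin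
  sum (λ i → if S (elem i) then f (elem i) else 0) ≡⟨ sum-cong-≗ spread ⟩
  sum (λ i → sum (λ j → δ i j))                    ≡⟨ ∑-comm δ ⟩
  sum (λ j → sum (λ i → δ i j))
    ≡⟨ sum-cong-≗ (λ j → sum-δ (Inverse.to iA (x j)) (f (x j))) ⟩
  sum (f ∘ x)                                      ∎
  where
  open ≡-Reasoning
  e = b ↔-∘ ↔-sym iB

  elem : Fin _ → A
  elem = Inverse.from iA

  x : Fin r → A
  x = proj₁ ∘ Inverse.to e

  δ : Fin _ → Fin r → ℕ
  δ i j = if does (i ≟ Inverse.to iA (x j)) then f (x j) else 0

  δ-outside : ∀ i → S (elem i) ≡ false → ∀ j → δ i j ≡ 0
  δ-outside i Sa j with i ≟ Inverse.to iA (x j)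
  ... | no _     = refl
  ... | yes refl = ⊥-elim (subst T (trans (cong S (sym (Inverse.strictlyInverseʳ iA (x j)))) Sa)
                                   (proj₂ (Inverse.to e j)))

  δ-inside : ∀ i (p : T (S (elem i))) j →
             δ i j ≡ (if does (j ≟ Inverse.from e (elem i , p)) then f (elem i) else 0)
  δ-inside i p j with i ≟ Inverse.to iA (x j) | j ≟ Inverse.from e (elem i , p)
  ... | no _  | no _  = refl
  ... | yes q | yes _ =
    cong f (sym (trans (cong elem q) (Inverse.strictlyInverseʳ iA (x j))))
  ... | yes q | no ¬q = contradiction
    (sym (trans (cong (Inverse.from e) (proj₁-injective
                  (trans (cong elem q) (Inverse.strictlyInverseʳ iA (x j)))))
                (Inverse.strictlyInverseʳ e j))) ¬q
  ... | no ¬q | yes refl = contradiction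
    (sym (trans (cong (Inverse.to iA ∘ proj₁) (Inverse.strictlyInverseˡ e (elem i , p)))
                (Inverse.strictlyInverseˡ iA i))) ¬q

  spread : ∀ i → (if S (elem i) then f (elem i) else 0) ≡ sum (δ i)
  spread i with S (elem i) in Sa
  ... | false = sym (trans (sum-cong-≗ (δ-outside i Sa)) (sum-replicate-zero r))
  ... | true  = sym (trans (sum-cong-≗ (δ-inside i p))
                           (sum-δ (Inverse.from e (elem i , p)) (f (elem i))))
    where p = subst T (sym Sa) _

-- Subgraphs isomorphic to a pattern graph, seen as embeddings.

image? : ∀ {A B : Set} → Finite A → Finite B → (f : A → B) → ∀ y → Dec (∃ λ x → f x ≡ y)
image? (finite iA) (finite iB) f y = map′
  (λ (i , eq) → Inverse.from iA i , to-injective iB eq)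
  (λ (x , eq) → Inverse.to iA x ,
                cong (Inverse.to iB) (trans (cong f (Inverse.strictlyInverseʳ iA x)) eq))
  (any? λ i → Inverse.to iB (f (Inverse.from iA i)) ≟ Inverse.to iB y)

image-↔ : ∀ {A B : Set} (finA : Finite A) (finB : Finite B) {f : A → B} → Injective _≡_ _≡_ f →
          Σ B (λ y → True (image? finA finB f y)) ↔ A
image-↔ finA finB {f} inj = mk↔ₛ′
  (λ (y , p) → proj₁ (toWitness {a? = image? finA finB f y} p))
  (λ x → f x , fromWitness (x , refl))
  (λ x → inj (proj₂ (toWitness {a? = image? finA finB f (f x)} (fromWitness (x , refl)))))
  (λ (y , p) → proj₁-injective (proj₂ (toWitness {a? = image? finA finB f y} p)))

≈-sym : ∀ {A : Set} {p q : A × A} → p ≈ q → q ≈ p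
≈-sym (inj₁ refl) = inj₁ refl
≈-sym (inj₂ refl) = inj₂ refl

≈-trans : ∀ {A : Set} {p q r : A × A} → p ≈ q → q ≈ r → p ≈ r
≈-trans (inj₁ refl) q≈r         = q≈r
≈-trans (inj₂ refl) (inj₁ refl) = inj₂ refl
≈-trans (inj₂ refl) (inj₂ refl) = inj₁ refl

≈-map⁺ : ∀ {A B : Set} (f : A → B) {p q : A × A} → p ≈ q → map f f p ≈ map f f q
≈-map⁺ f (inj₁ refl) = inj₁ refl
≈-map⁺ f (inj₂ refl) = inj₂ refl

-- Embeddings stand in for subgraphs isomorphic to `H`: they compose with inclusions, and they name
-- the image of each vertex and edge. Injectivity on edges is derived from the simplicity of `H`.
record Embedding (H G : Graph) : Set where
  private
    module H = Graph H
    module G = Graph G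
  field
    onV            : H.V → G.V
    onE            : H.E → G.E
    onV-injective  : Injective _≡_ _≡_ onV
    preserves-ends : ∀ e → G.ends (onE e) ≈ map onV onV (H.ends e)

  onE-injective : Injective _≡_ _≡_ onE
  onE-injective {e} {e′} eq = H.simple (≈-map⁻ onV-injective
    (≈-trans (≈-sym (preserves-ends e)) (≈-trans (inj₁ (cong G.ends eq)) (preserves-ends e′))))

  -- Membership in a subgraph is `Bool`-valued, so lying in the image has to be decided; `image?`
  -- does so by exhaustive search.
  image : Subgraph G.simpleGraph
  image = record
    { inV    = λ v → isYes (image? H.finiteV G.finiteV onV v)
    ; inE    = λ e → isYes (image? H.finiteE G.finiteE onE e)
    ; closed = λ e p → closed (toWitness {a? = image? H.finiteE G.finiteE onE e} p)
    }
    where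
    closed : ∀ {e} → (∃ λ d → onE d ≡ e) →
             True (image? H.finiteV G.finiteV onV (proj₁ (G.ends e))) ×
             True (image? H.finiteV G.finiteV onV (proj₂ (G.ends e)))
    closed (d , refl) with preserves-ends d
    ... | inj₁ eq = fromWitness (_ , sym (cong proj₁ eq)) , fromWitness (_ , sym (cong proj₂ eq))
    ... | inj₂ eq = fromWitness (_ , sym (cong proj₁ eq)) , fromWitness (_ , sym (cong proj₂ eq))

  image-≅ : Subgraph.asGraph image ≅ H.simpleGraph
  image-≅ = record { V↔ = V↔ ; E↔ = E↔ ; preserves-ends = ends-≈ }
    where
    V↔ = image-↔ H.finiteV G.finiteV onV-injective

    E↔ = image-↔ H.finiteE G.finiteE onE-injective

    onV-to : ∀ v → onV (Inverse.to V↔ v) ≡ proj₁ v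
    onV-to (v , p) = proj₂ (toWitness {a? = image? H.finiteV G.finiteV onV v} p)

    ends-≈ : ∀ e → H.ends (Inverse.to E↔ e) ≈
             map (Inverse.to V↔) (Inverse.to V↔) (SimpleGraph.ends (Subgraph.asGraph image) e)
    ends-≈ e@(e₀ , p) = ≈-map⁻ onV-injective (≈-trans (≈-sym (preserves-ends _))
      (inj₁ (trans (cong G.ends (proj₂ (toWitness {a? = image? H.finiteE G.finiteE onE e₀} p)))
                   (sym (cong₂ _,_ (onV-to _) (onV-to _))))))

fromSubgraph : ∀ {H G} → SubgraphIsoTo H G → Embedding H G
fromSubgraph {H} {G} (S , iso) = record
  { onV            = proj₁ ∘ Inverse.from V↔
  ; onE            = proj₁ ∘ Inverse.from E↔
  ; onV-injective  = to-injective (↔-sym V↔) ∘ proj₁-injective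
  ; preserves-ends = λ e → ≈-map⁺ proj₁ (ends-≈ e)
  }
  where
  open _≅_ iso using (V↔; E↔; preserves-ends)
  module H = Graph H
  module S = SimpleGraph (Subgraph.asGraph S)

  ends-≈ : ∀ e → S.ends (Inverse.from E↔ e) ≈ map (Inverse.from V↔) (Inverse.from V↔) (H.ends e)
  ends-≈ e = ≈-sym (≈-trans
    (inj₁ (cong (map (Inverse.from V↔) (Inverse.from V↔) ∘ H.ends)
                (sym (Inverse.strictlyInverseˡ E↔ e))))
    (≈-trans (≈-map⁺ (Inverse.from V↔) (preserves-ends (Inverse.from E↔ e)))
             (inj₁ (cong₂ _,_ (Inverse.strictlyInverseʳ V↔ _) (Inverse.strictlyInverseʳ V↔ _)))))

-- When `H` is a triangle, both sums on the right compute to explicit three-term sums, and the magic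
-- condition becomes plain arithmetic.
weight-embedding : ∀ {H G} (ℓ : Labeling G) (S : SubgraphIsoTo H G) →
  let open Embedding (fromSubgraph {H} {G} S) in
  weight G ℓ (proj₁ S) ≡ ∑ (Graph.finiteV H) (const true) (label G ℓ ∘ inj₁ ∘ onV)
                       + ∑ (Graph.finiteE H) (const true) (label G ℓ ∘ inj₂ ∘ onE)
weight-embedding {H} {G} ℓ (S , iso) = cong₂ _+_
  (∑-subset (Graph.finiteV G) (Graph.finiteV H) _ (↔-sym (_≅_.V↔ iso)) (label G ℓ ∘ inj₁))
  (∑-subset (Graph.finiteE G) (Graph.finiteE H) _ (↔-sym (_≅_.E↔ iso)) (label G ℓ ∘ inj₂))

-- The covering condition in terms of embeddings, which passes to copies and unions by composing
-- with inclusions.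
Covered : Graph → Graph → Set
Covered H G = ∀ e → Σ (Embedding H G) λ f → ∃ λ d → Embedding.onE f d ≡ e

covered⇒covering : ∀ {H G} → Covered H G → HasCovering H G
covered⇒covering cov e with f , d∈ ← cov e =
  (Embedding.image f , Embedding.image-≅ f) , fromWitness d∈

-- Labelings from injective bounded numberings.

injective⇒surjective : ∀ {n} {f : Fin n → Fin n} → Injective _≡_ _≡_ f → ∀ j → ∃ λ i → f i ≡ j
injective⇒surjective {suc n} {f} inj j with any? (λ i → f i ≟ j)
... | yes hit  = hit
... | no  miss = contradiction
  -- Punching out the missed value would inject `Fin (suc n)` into `Fin n`.
  (injective⇒≤ (λ {i} {i′} → inj ∘ punchOut-injective (missed i) (missed i′))) 1+n≰n
  where
  missed : ∀ i → j ≢ f i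
  missed i j≡fi = miss (i , sym j≡fi)

-- Counting supplies surjectivity, so the numberings below only have to be injective and bounded by
-- the size.
enumeration : ∀ {A : Set} (finA : Finite A) (f : A → ℕ) →
              Injective _≡_ _≡_ f → (∀ x → f x < size finA) →
              Σ (A ⤖ Fin (size finA)) λ b → ∀ x → toℕ (Bijection.to b x) ≡ f x
enumeration finA@(finite i) f inj f< =
  mk⤖ (fin-injective , surjective) , λ x → toℕ-fromℕ< (f< x)
  where
  fin : _ → Fin (size finA)
  fin x = fromℕ< (f< x)

  fin-injective : Injective _≡_ _≡_ fin
  fin-injective {x} {y} eq = inj (fromℕ<-injective _ _ (f< x) (f< y) eq)

  surjective : Surjective _≡_ _≡_ fin
  surjective j with j′ , eq ← injective⇒surjective (to-injective (↔-sym i) ∘ fin-injective) j =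
    Inverse.from i j′ , λ { refl → eq }

module _ (G : Graph) where

  open Graph G

  -- The edge numbering is reversed and put above the vertex labels, so `ψ e` is the distance from
  -- the label of `e` to the largest label. The sum form avoids truncated subtraction.
  labeling : (φ : V → ℕ) → Injective _≡_ _≡_ φ → (∀ v → φ v < ∣V∣) →
             (ψ : E → ℕ) → Injective _≡_ _≡_ ψ → (∀ e → ψ e < ∣E∣) →
             ∃ λ (ℓ : Labeling G) →
               (∀ v → label G ℓ (inj₁ v) ≡ suc (φ v)) ×
               (∀ e → label G ℓ (inj₂ e) + ψ e ≡ ∣V∣ + ∣E∣) ×
               VerticesFirst G ℓ
  labeling φ φ-inj φ< ψ ψ-inj ψ<
    with bⱽ , bⱽ≡φ ← enumeration finiteV φ φ-inj φ<
       | bᴱ , bᴱ≡ψ ← enumeration finiteE ψ ψ-inj ψ< =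
    ℓ , label-V , label-E , λ m → mk⇔ (λ { (v , refl) → within v }) (hit m)
    where
    ℓ : Labeling G
    ℓ = ↔⇒⤖ (↔-sym +↔⊎) ⤖-∘ (bⱽ ⊎-⤖ (↔⇒⤖ reverse ⤖-∘ bᴱ))

    label-V : ∀ v → label G ℓ (inj₁ v) ≡ suc (φ v)
    label-V v = cong suc (trans (toℕ-↑ˡ (Bijection.to bⱽ v) ∣E∣) (bⱽ≡φ v))

    label-E : ∀ e → label G ℓ (inj₂ e) + ψ e ≡ ∣V∣ + ∣E∣
    label-E e = begin
      label G ℓ (inj₂ e) + ψ e              ≡⟨ cong (λ t → suc t + ψ e) (toℕ-↑ʳ ∣V∣ _) ⟩
      suc (∣V∣ + toℕ _) + ψ e
        ≡⟨ cong (λ t → suc (∣V∣ + t) + ψ e) (opposite-prop (Bijection.to bᴱ e)) ⟩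
      suc (∣V∣ + (∣E∣ ∸ suc (toℕ _))) + ψ e
        ≡⟨ cong (λ t → suc (∣V∣ + (∣E∣ ∸ suc t)) + ψ e) (bᴱ≡ψ e) ⟩
      suc (∣V∣ + (∣E∣ ∸ suc (ψ e))) + ψ e   ≡⟨ sym (+-suc (∣V∣ + (∣E∣ ∸ suc (ψ e))) (ψ e)) ⟩
      ∣V∣ + (∣E∣ ∸ suc (ψ e)) + suc (ψ e)   ≡⟨ +-assoc ∣V∣ _ _ ⟩
      ∣V∣ + (∣E∣ ∸ suc (ψ e) + suc (ψ e))   ≡⟨ cong (∣V∣ +_) (m∸n+n≡m (ψ< e)) ⟩
      ∣V∣ + ∣E∣                             ∎
      where open ≡-Reasoning

    within : ∀ v → 1 ≤ label G ℓ (inj₁ v) × label G ℓ (inj₁ v) ≤ ∣V∣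
    within v = s≤s z≤n , subst (_≤ ∣V∣) (sym (label-V v)) (φ< v)

    hit : ∀ m → 1 ≤ m × m ≤ ∣V∣ → ∃ λ v → label G ℓ (inj₁ v) ≡ m
    hit (suc m) (_ , m<∣V∣) with v , to-v ← Bijection.surjective bⱽ (fromℕ< m<∣V∣) =
      v , trans (label-V v) (cong suc (trans (sym (bⱽ≡φ v))
                                             (trans (cong toℕ (to-v refl)) (toℕ-fromℕ< m<∣V∣))))

-- Covering unions of fans by triangles.

lift-copies : ∀ {H G} s → Covered H G → Covered H (s · G)
lift-copies s cov (i , e) with f , d , refl ← cov e = record
  { onV            = (i ,_) ∘ onV
  ; onE            = (i ,_) ∘ onE
  ; onV-injective  = onV-injective ∘ ,-injectiveʳ
  ; preserves-ends = λ e → ≈-map⁺ (i ,_) (preserves-ends e)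
  } , d , refl
  where open Embedding f

lift-∪ : ∀ {H G G′} → Covered H G → Covered H G′ → Covered H (G ∪ G′)
lift-∪ cov cov′ (inj₁ e) with f , d , refl ← cov e = record
  { onV            = inj₁ ∘ onV
  ; onE            = inj₁ ∘ onE
  ; onV-injective  = onV-injective ∘ inj₁-injective
  ; preserves-ends = λ e → ≈-map⁺ inj₁ (preserves-ends e)
  } , d , refl
  where open Embedding f
lift-∪ cov cov′ (inj₂ e) with f , d , refl ← cov′ e = record
  { onV            = inj₂ ∘ onV
  ; onE            = inj₂ ∘ onE
  ; onV-injective  = onV-injective ∘ inj₂-injective
  ; preserves-ends = λ e → ≈-map⁺ inj₂ (preserves-ends e)
  } , d , refl
  where open Embedding f

fan-triangle : ∀ n → Fin n → Embedding (C 3 ≤-refl) (F (suc n))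
fan-triangle n i = record
  { onV            = vertex
  ; onE            = edge
  ; onV-injective  = λ {x} {y} → vertex-injective x y
  ; preserves-ends = λ where
      (inj₁ zero)       → inj₁ refl
      (inj₁ (suc zero)) → inj₁ refl
      -- The closing edge of the cycle lists the hub second, whereas a spoke lists it first.
      (inj₂ tt)         → inj₂ refl
  }
  where
  vertex : Fin 3 → ⊤ ⊎ Fin (suc n)
  vertex zero             = inj₁ tt
  vertex (suc zero)       = inj₂ (inject₁ i)
  vertex (suc (suc zero)) = inj₂ (suc i)

  edge : Fin 2 ⊎ ⊤ → Fin (suc n) ⊎ Fin n
  edge (inj₁ zero)       = inj₁ (inject₁ i)
  edge (inj₁ (suc zero)) = inj₂ i
  edge (inj₂ tt)         = inj₁ (suc i)

  vertex-injective : ∀ x y → vertex x ≡ vertex y → x ≡ y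
  vertex-injective zero             zero             _  = refl
  vertex-injective zero             (suc zero)       ()
  vertex-injective zero             (suc (suc zero)) ()
  vertex-injective (suc zero)       (suc zero)       _  = refl
  vertex-injective (suc zero)       (suc (suc zero)) eq = ⊥-elim (inject₁≢suc i (inj₂-injective eq))
  vertex-injective (suc (suc zero)) (suc zero)       eq = ⊥-elim (inject₁≢suc i (sym (inj₂-injective eq)))
  vertex-injective (suc (suc zero)) (suc (suc zero)) _  = refl

-- Triangle `i` consists of spokes `i` and `i + 1` and path edge `i`. Spoke `0` has no triangle
-- before it and is taken from the one after it.
fan-covered : ∀ n → Covered (C 3 ≤-refl) (F (suc (suc n)))
fan-covered n (inj₁ zero)    = fan-triangle (suc n) zero , inj₁ zero , refl
fan-covered n (inj₁ (suc i)) = fan-triangle (suc n) i , inj₂ tt , refl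
fan-covered n (inj₂ i)       = fan-triangle (suc n) i , inj₁ (suc zero) , refl

-- The zigzag order of the spokes.

data Parity : ℕ → Set where
  even : ∀ c → Parity (c + c)
  odd  : ∀ c → Parity (suc (c + c))

parity : ∀ n → Parity n
parity zero    = even zero
parity (suc n) with parity n
... | even c = odd c
... | odd c  = subst Parity (cong suc (+-suc c c)) (even (suc c))

double-cancel-< : ∀ {c d} → c + c < d + d → c < d
double-cancel-< c+c<d+d = ≰⇒> λ d≤c → <⇒≱ c+c<d+d (+-mono-≤ d≤c d≤c)

-- The interleaving `a, b, a + 1, b + 1, a + 2, ...` of two runs of consecutive numbers.
zigzag : ℕ → ℕ → ℕ → ℕ
zigzag a b zero    = a
zigzag a b (suc i) = zigzag b (suc a) i

-- Replacing the pair `a, b` by its successor `b, suc a` raises the sum by one.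
zigzag-sum : ∀ a b i → zigzag a b i + zigzag a b (suc i) ≡ i + (a + b)
zigzag-sum a b zero    = refl
zigzag-sum a b (suc i) = trans (zigzag-sum b (suc a) i) (lemma a b i)
  where
  lemma : ∀ a b i → i + (b + suc a) ≡ suc i + (a + b)
  lemma = solve-∀

zigzag-even : ∀ a b c → zigzag a b (c + c) ≡ a + c
zigzag-even a b zero    = sym (+-identityʳ a)
zigzag-even a b (suc c) rewrite +-suc c c = trans (zigzag-even (suc a) (suc b) c) (sym (+-suc a c))

zigzag-odd : ∀ a b c → zigzag a b (suc (c + c)) ≡ b + c
zigzag-odd a b = zigzag-even b (suc a)

-- Each of the two runs is injective by cancellation, so only a meeting of the runs has to be
-- excluded; this is `sep`.
zigzag-injective : ∀ {a b n} → (∀ c d → c + c ≤ n → suc (d + d) ≤ n → a + c ≢ b + d) →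
                   ∀ {i j} → i ≤ n → j ≤ n → zigzag a b i ≡ zigzag a b j → i ≡ j
zigzag-injective {a} {b} sep {i} {j} i≤n j≤n eq with parity i | parity j
... | even c | even d rewrite zigzag-even a b c | zigzag-even a b d with refl ← +-cancelˡ-≡ a c d eq = refl
... | odd c  | odd d  rewrite zigzag-odd a b c | zigzag-odd a b d with refl ← +-cancelˡ-≡ b c d eq = refl
... | even c | odd d  rewrite zigzag-even a b c | zigzag-odd a b d = ⊥-elim (sep c d i≤n j≤n eq)
... | odd d  | even c rewrite zigzag-even a b c | zigzag-odd a b d = ⊥-elim (sep c d j≤n i≤n (sym eq))

-- One order serves both kinds of fan: `u` permutes `0` to `n` for the longer ones and, by `u-last`
-- and `u-<`, `0` to `n - 1` for the shorter ones.
record SpokeOrder (n : ℕ) : Set where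
  field
    u           : ℕ → ℕ
    q           : ℕ
    u-sum       : ∀ i → u i + u (suc i) ≡ i + q
    u-last      : u n ≡ n
    u-<         : ∀ {i} → i < n → u i < n
    u-injective : ∀ {i j} → i ≤ n → j ≤ n → u i ≡ u j → i ≡ j

  u-≤ : ∀ {i} → i ≤ n → u i ≤ n
  u-≤ i≤n with m≤n⇒m<n∨m≡n i≤n
  ... | inj₁ i<n  = <⇒≤ (u-< i<n)
  ... | inj₂ refl = ≤-reflexive u-last

-- The run containing position `n` must be the upper one, so that it ends with the value `n`. For
-- `n = 2p` the even positions take `p` to `2p` and the odd ones `0` to `p - 1`; for `n = 2p + 1`
-- the even positions take `0` to `p` and the odd ones `p + 1` to `2p + 1`.
spokeOrder : ∀ n → SpokeOrder n
spokeOrder n with parity n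
... | even p = record
  { u           = zigzag p 0
  ; q           = p + 0
  ; u-sum       = zigzag-sum p 0
  ; u-last      = zigzag-even p 0 p
  ; u-<         = below
  ; u-injective = zigzag-injective λ c d _ d<p eq →
      <⇒≱ (double-cancel-< d<p) (subst (p ≤_) eq (m≤m+n p c))
  }
  where
  below : ∀ {i} → i < p + p → zigzag p 0 i < p + p
  below {i} i<n with parity i
  ... | even c rewrite zigzag-even p 0 c = +-monoʳ-< p (double-cancel-< i<n)
  ... | odd c  rewrite zigzag-odd p 0 c  = <-≤-trans (double-cancel-< (<-trans (n<1+n _) i<n)) (m≤m+n p p)
... | odd p = record
  { u           = zigzag 0 (suc p)
  ; q           = suc p
  ; u-sum       = zigzag-sum 0 (suc p)
  ; u-last      = zigzag-odd 0 (suc p) p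
  ; u-<         = below
  ; u-injective = zigzag-injective λ c d c≤p _ eq →
      <⇒≱ (subst (p <_) (sym eq) (m≤m+n (suc p) d)) (c≤ c≤p)
  }
  where
  c≤ : ∀ {c} → c + c ≤ suc (p + p) → c ≤ p
  c≤ {c} le = ≤-pred (double-cancel-< (≤-trans (s≤s le) (≤-reflexive (cong suc (sym (+-suc p p))))))

  below : ∀ {i} → i < suc (p + p) → zigzag 0 (suc p) i < suc (p + p)
  below {i} i<n with parity i
  ... | even c rewrite zigzag-even 0 (suc p) c = s≤s (≤-trans (c≤ (<⇒≤ i<n)) (m≤m+n p p))
  ... | odd c  rewrite zigzag-odd 0 (suc p) c  = +-monoʳ-< (suc p) (double-cancel-< (≤-pred i<n))

-- Numbering a table whose columns have two lengths.

digits-< : ∀ m {a b c} d → c < m → a < b → m * a + c < m * b + d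
digits-< m {a} {b} {c} d c<m a<b = begin-strict
  m * a + c  <⟨ +-monoʳ-< (m * a) c<m ⟩
  m * a + m  ≡⟨ trans (+-comm (m * a) m) (sym (*-suc m a)) ⟩
  m * suc a  ≤⟨ *-monoʳ-≤ m a<b ⟩
  m * b      ≤⟨ m≤m+n (m * b) d ⟩
  m * b + d  ∎
  where open ≤-Reasoning

digits-injective : ∀ m {a b c d} → c < m → d < m → m * a + c ≡ m * b + d → a ≡ b × c ≡ d
digits-injective m {a} {b} {c} {d} c<m d<m eq with <-cmp a b
... | tri< a<b _ _  = contradiction eq (<⇒≢ (digits-< m d c<m a<b))
... | tri≈ _ refl _ = refl , +-cancelˡ-≡ (m * a) c d eq
... | tri> _ _ b<a  = contradiction (sym eq) (<⇒≢ (digits-< m c d<m b<a))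

module _ (s k : ℕ) where

  Copies : Set → Set → Set
  Copies A B = Fin s × A ⊎ Fin k × B

  column : ∀ {A B} → Copies A B → ℕ
  column (inj₁ (i , _)) = toℕ i
  column (inj₂ (i , _)) = s + toℕ i

  onCopies : ∀ {A B : Set} → (A → ℕ) → (B → ℕ) → Copies A B → ℕ
  onCopies f g = [ f ∘ proj₂ , g ∘ proj₂ ]′

  column-< : ∀ {A B} (x : Copies A B) → column x < s + k
  column-< (inj₁ (i , _)) = <-≤-trans (toℕ<n i) (m≤m+n s k)
  column-< (inj₂ (i , _)) = +-monoʳ-< s (toℕ<n i)

  place : ∀ {A B : Set} → (A → ℕ) → (B → ℕ) → Copies A B → ℕ
  place f g x = (s + k) * onCopies f g x + column x

  module _ {A B : Set} {f : A → ℕ} {g : B → ℕ} where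

    onCopies-injective : Injective _≡_ _≡_ f → Injective _≡_ _≡_ g → ∀ x y →
                         onCopies f g x ≡ onCopies f g y → column x ≡ column y → x ≡ y
    onCopies-injective f-inj g-inj (inj₁ (i , a)) (inj₁ (j , b)) r c =
      cong inj₁ (cong₂ _,_ (toℕ-injective c) (f-inj r))
    onCopies-injective f-inj g-inj (inj₂ (i , a)) (inj₂ (j , b)) r c =
      cong inj₂ (cong₂ _,_ (toℕ-injective (+-cancelˡ-≡ s _ _ c)) (g-inj r))
    onCopies-injective f-inj g-inj (inj₁ (i , a)) (inj₂ (j , b)) r c =
      contradiction c (<⇒≢ (<-≤-trans (toℕ<n i) (m≤m+n s (toℕ j))))
    onCopies-injective f-inj g-inj (inj₂ (i , a)) (inj₁ (j , b)) r c =
      contradiction (sym c) (<⇒≢ (<-≤-trans (toℕ<n j) (m≤m+n s (toℕ i))))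

    place-injective : Injective _≡_ _≡_ f → Injective _≡_ _≡_ g → Injective _≡_ _≡_ (place f g)
    place-injective f-inj g-inj {x} {y} eq
      with r , c ← digits-injective (s + k) (column-< x) (column-< y) eq =
      onCopies-injective f-inj g-inj x y r c

    -- The table has `p` full rows and one more row that only the first `s` columns reach. When `f`
    -- and `g` exhaust their ranges, the bound is the number of cells.
    place-< : ∀ {p} → (∀ a → f a ≤ p) → (∀ b → g b < p) → ∀ x → place f g x < (s + k) * p + s
    place-< f≤ g< (inj₁ (i , a)) = +-mono-≤-< (*-monoʳ-≤ (s + k) (f≤ a)) (toℕ<n i)
    -- The leading digit decides the comparison, so the bound `s` may stand in the place of a last
    -- digit.
    place-< f≤ g< x@(inj₂ (i , b)) = digits-< (s + k) s (column-< x) (g< b)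

-- Triangles inside one column.

module Triangles (m N q : ℕ) (u : ℕ → ℕ) (u-sum : ∀ i → u i + u (suc i) ≡ i + q) where

  -- Link j a b w: in column j, an edge of weight w joins the rows a < b; the
  -- weight says how far the label of the edge lies below the largest label.
  data Link (j : ℕ) : ℕ → ℕ → ℕ → Set where
    spoke : ∀ i → Link j 0 (suc i) (m * u i + j)
    path  : ∀ i → Link j (suc i) (suc (suc i)) (N + (m * i + j))

  Joined : ℕ → ℕ → ℕ → ℕ → Set
  Joined j a b w = Link j a b w ⊎ Link j b a w

  -- Vertex places and edge weights differ by a constant, with both parts of the constant added so
  -- that nothing is subtracted. Wrapping the equation in a record keeps rows and weights visible to
  -- unification.
  record Balanced (j a b c w₁ w₂ w₃ : ℕ) : Set where
    constructor balance
    field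
      sums : m * a + j + (m * b + j + (m * c + j)) + (N + m * q) ≡ w₁ + (w₂ + w₃) + 3 * m

  balanced-rotate : ∀ {j a b c w₁ w₂ w₃} → Balanced j b c a w₂ w₃ w₁ → Balanced j a b c w₁ w₂ w₃
  balanced-rotate {j} {a} {b} {c} {w₁} {w₂} {w₃} (balance eq) = balance (begin
    m * a + j + (m * b + j + (m * c + j)) + (N + m * q)
      ≡⟨ cong (_+ (N + m * q)) (rotate (m * a + j) (m * b + j) (m * c + j)) ⟩
    m * b + j + (m * c + j + (m * a + j)) + (N + m * q) ≡⟨ eq ⟩
    w₂ + (w₃ + w₁) + 3 * m                              ≡⟨ cong (_+ 3 * m) (sym (rotate w₁ w₂ w₃)) ⟩
    w₁ + (w₂ + w₃) + 3 * m                              ∎)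
    where
    open ≡-Reasoning
    rotate : ∀ x y z → x + (y + z) ≡ y + (z + x)
    rotate = solve-∀

  balanced-reflect : ∀ {j a b c w₁ w₂ w₃} → Balanced j a c b w₃ w₂ w₁ → Balanced j a b c w₁ w₂ w₃
  balanced-reflect {j} {a} {b} {c} {w₁} {w₂} {w₃} (balance eq) = balance (begin
    m * a + j + (m * b + j + (m * c + j)) + (N + m * q)
      ≡⟨ cong (λ t → m * a + j + t + (N + m * q)) (+-comm (m * b + j) (m * c + j)) ⟩
    m * a + j + (m * c + j + (m * b + j)) + (N + m * q) ≡⟨ eq ⟩
    w₃ + (w₂ + w₁) + 3 * m                              ≡⟨ cong (_+ 3 * m) (swap-outer w₃ w₂ w₁) ⟩
    w₁ + (w₂ + w₃) + 3 * m                              ∎)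
    where
    open ≡-Reasoning
    swap-outer : ∀ x y z → x + (y + z) ≡ z + (y + x)
    swap-outer = solve-∀

  -- As `i` grows by one, the vertex side gains `2 * m`; the path edge gains `m` and, by `u-sum`,
  -- the two spokes together gain `m`. The constant `3 * m` comes from the rows `i + 1` and `i + 2`,
  -- `N` from the offset of path edges and `m * q` from `u-sum`.
  balanced-consecutive : ∀ j i → Balanced j 0 (suc i) (suc (suc i))
                                   (m * u i + j) (N + (m * i + j)) (m * u (suc i) + j)
  balanced-consecutive j i = balance (begin
    m * 0 + j + (m * suc i + j + (m * suc (suc i) + j)) + (N + m * q)
      ≡⟨ vertices m i j N q ⟩
    m * (i + q) + (m * i + 3 * j + N + 3 * m)
      ≡⟨ cong (λ t → m * t + (m * i + 3 * j + N + 3 * m)) (sym (u-sum i)) ⟩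
    m * (u i + u (suc i)) + (m * i + 3 * j + N + 3 * m)
      ≡⟨ edges m i j N (u i) (u (suc i)) ⟩
    m * u i + j + (N + (m * i + j) + (m * u (suc i) + j)) + 3 * m ∎)
    where
    open ≡-Reasoning
    vertices : ∀ m i j N q → m * 0 + j + (m * suc i + j + (m * suc (suc i) + j)) + (N + m * q) ≡
                             m * (i + q) + (m * i + 3 * j + N + 3 * m)
    vertices = solve-∀
    edges : ∀ m i j N x y → m * (x + y) + (m * i + 3 * j + N + 3 * m) ≡
                            m * x + j + (N + (m * i + j) + (m * y + j)) + 3 * m
    edges = solve-∀

  -- No link ends in row `0`, so the links at the hub are spokes leaving it. The third link is then
  -- a path edge, traversed in one of two directions.
  balanced-hub : ∀ {j b c w₁ w₂ w₃} → Joined j 0 b w₁ → Joined j b c w₂ → Joined j c 0 w₃ →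
                 Balanced j 0 b c w₁ w₂ w₃
  balanced-hub {j} (inj₁ (spoke .i)) (inj₁ (path i)) (inj₂ (spoke .(suc i))) =
    balanced-consecutive j i
  balanced-hub {j} (inj₁ (spoke .(suc i))) (inj₂ (path i)) (inj₂ (spoke .i)) =
    balanced-reflect (balanced-consecutive j i)

  -- Each path edge changes the row by one, and three such changes cannot cancel.
  no-path-triangle : ∀ {j a b c w₁ w₂ w₃} →
    Joined j (suc a) (suc b) w₁ → Joined j (suc b) (suc c) w₂ → Joined j (suc c) (suc a) w₃ → ⊥
  no-path-triangle (inj₁ (path _)) (inj₁ (path _)) (inj₁ ())
  no-path-triangle (inj₁ (path _)) (inj₁ (path _)) (inj₂ ())
  no-path-triangle (inj₁ (path _)) (inj₂ (path _)) (inj₁ ())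
  no-path-triangle (inj₁ (path _)) (inj₂ (path _)) (inj₂ ())
  no-path-triangle (inj₂ (path _)) (inj₁ (path _)) (inj₁ ())
  no-path-triangle (inj₂ (path _)) (inj₁ (path _)) (inj₂ ())
  no-path-triangle (inj₂ (path _)) (inj₂ (path _)) (inj₁ ())
  no-path-triangle (inj₂ (path _)) (inj₂ (path _)) (inj₂ ())

  -- Some vertex of the triangle is the hub, and rotation brings it to the front.
  balanced : ∀ {j} a b c {w₁ w₂ w₃} → Joined j a b w₁ → Joined j b c w₂ → Joined j c a w₃ →
             Balanced j a b c w₁ w₂ w₃
  balanced zero    b       c       ab bc ca = balanced-hub ab bc ca
  balanced (suc a) zero    c       ab bc ca = balanced-rotate (balanced-hub bc ca ab)
  balanced (suc a) (suc b) zero    ab bc ca = balanced-rotate (balanced-rotate (balanced-hub ca ab bc))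
  balanced (suc a) (suc b) (suc c) ab bc ca = ⊥-elim (no-path-triangle ab bc ca)

-- The labeling of the union of fans.

rowᶠ : ∀ {n} → ⊤ ⊎ Fin n → ℕ
rowᶠ (inj₁ _) = 0
rowᶠ (inj₂ i) = suc (toℕ i)

rowᶠ-injective : ∀ {n} → Injective _≡_ _≡_ (rowᶠ {n})
rowᶠ-injective {x = inj₁ _} {inj₁ _} _  = refl
rowᶠ-injective {x = inj₂ i} {inj₂ j} eq = cong inj₂ (toℕ-injective (suc-injective eq))

rowᶠ-≤ : ∀ {n} (v : ⊤ ⊎ Fin n) → rowᶠ v ≤ n
rowᶠ-≤ (inj₁ _) = z≤n
rowᶠ-≤ (inj₂ i) = toℕ<n i

-- Passes from places and downward weights to actual labels. The trailing zeros match the form in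
-- which sums over three indices compute.
balance-labels : ∀ x y z x′ y′ z′ {w a b c a′ b′ c′ t r p} →
  w ≡ a + (b + (c + 0)) + (x + (y + (z + 0))) →
  a ≡ suc a′ → b ≡ suc b′ → c ≡ suc c′ → x + x′ ≡ t → y + y′ ≡ t → z + z′ ≡ t →
  a′ + (b′ + c′) + r ≡ x′ + (y′ + z′) + p → w + r ≡ 3 + 3 * t + p
balance-labels x y z x′ y′ z′ {a′ = a} {b} {c} {t} {r} {p} refl refl refl refl xt yt zt eq =
  -- With the downward weights added on both sides, each edge label pairs with its own weight to
  -- give `t`.
  +-cancelˡ-≡ (x′ + (y′ + z′)) _ _ (begin
    x′ + (y′ + z′) + (suc a + (suc b + (suc c + 0)) + (x + (y + (z + 0))) + r)
      ≡⟨ regroup a b c x y z x′ y′ z′ r ⟩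
    3 + (x + x′ + (y + y′ + (z + z′))) + (a + (b + c) + r)
      ≡⟨ cong₂ (λ k l → 3 + k + l) (cong₂ _+_ xt (cong₂ _+_ yt zt)) eq ⟩
    3 + (t + (t + t)) + (x′ + (y′ + z′) + p)
      ≡⟨ collect t x′ y′ z′ p ⟩
    x′ + (y′ + z′) + (3 + 3 * t + p) ∎)
  where
  open ≡-Reasoning
  regroup : ∀ a b c x y z x′ y′ z′ r →
    x′ + (y′ + z′) + (suc a + (suc b + (suc c + 0)) + (x + (y + (z + 0))) + r) ≡
    3 + (x + x′ + (y + y′ + (z + z′))) + (a + (b + c) + r)
  regroup = solve-∀
  collect : ∀ t x′ y′ z′ p → 3 + (t + (t + t)) + (x′ + (y′ + z′) + p) ≡ x′ + (y′ + z′) + (3 + 3 * t + p)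
  collect = solve-∀

module _ (s k n-1 : ℕ) (order : SpokeOrder (suc n-1)) where

  open SpokeOrder order

  private
    n m N : ℕ
    n = suc n-1
    m = s + k
    N = m * n + s

  open Triangles m N q u u-sum

  G : Graph
  G = s · F (suc n) ∪ k · F n

  open Graph G

  row : V → ℕ
  row = onCopies s k rowᶠ rowᶠ

  col : V → ℕ
  col = column s k

  φ : V → ℕ
  φ = place s k rowᶠ rowᶠ

  φ-< : ∀ v → φ v < ∣V∣
  φ-< v = <-≤-trans (place-< s k {p = suc n} rowᶠ-≤ (s≤s ∘ rowᶠ-≤) v) (≤-reflexive (count s k n-1))
    where
    count : ∀ s k n-1 → (s + k) * suc (suc n-1) + s ≡
                        s * (1 + suc (suc n-1)) + k * (1 + suc n-1)
    count = solve-∀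

  Spokes Paths : Set
  Spokes = Copies s k (Fin (suc n)) (Fin n)
  Paths  = Copies s k (Fin n) (Fin n-1)

  -- Regroups the edges so that all spokes share one table and all path edges a second one.
  split : E → Spokes ⊎ Paths
  split (inj₁ (i , inj₁ p)) = inj₁ (inj₁ (i , p))
  split (inj₁ (i , inj₂ p)) = inj₂ (inj₁ (i , p))
  split (inj₂ (i , inj₁ p)) = inj₁ (inj₂ (i , p))
  split (inj₂ (i , inj₂ p)) = inj₂ (inj₂ (i , p))

  unsplit : Spokes ⊎ Paths → E
  unsplit (inj₁ (inj₁ (i , p))) = inj₁ (i , inj₁ p)
  unsplit (inj₂ (inj₁ (i , p))) = inj₁ (i , inj₂ p)
  unsplit (inj₁ (inj₂ (i , p))) = inj₂ (i , inj₁ p)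
  unsplit (inj₂ (inj₂ (i , p))) = inj₂ (i , inj₂ p)

  unsplit-split : ∀ e → unsplit (split e) ≡ e
  unsplit-split (inj₁ (i , inj₁ p)) = refl
  unsplit-split (inj₁ (i , inj₂ p)) = refl
  unsplit-split (inj₂ (i , inj₁ p)) = refl
  unsplit-split (inj₂ (i , inj₂ p)) = refl

  spoke-place : Spokes → ℕ
  spoke-place = place s k (u ∘ toℕ) (u ∘ toℕ)

  spoke-place-< : ∀ x → spoke-place x < N
  spoke-place-< = place-< s k (λ i → u-≤ (toℕ≤pred[n] i)) (λ i → u-< (toℕ<n i))

  path-place : Paths → ℕ
  path-place = place s k toℕ toℕ

  ψ′ : Spokes ⊎ Paths → ℕ
  ψ′ = [ spoke-place , (N +_) ∘ path-place ]′

  ψ : E → ℕ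
  ψ = ψ′ ∘ split

  ψ′-injective : Injective _≡_ _≡_ ψ′
  ψ′-injective {inj₁ x} {inj₁ y} eq = cong inj₁ (place-injective s k
    (toℕ-injective ∘ u-injective (toℕ≤pred[n] _) (toℕ≤pred[n] _))
    (toℕ-injective ∘ u-injective (<⇒≤ (toℕ<n _)) (<⇒≤ (toℕ<n _))) eq)
  ψ′-injective {inj₁ x} {inj₂ y} eq =
    contradiction eq (<⇒≢ (<-≤-trans (spoke-place-< x) (m≤m+n N (path-place y))))
  ψ′-injective {inj₂ x} {inj₁ y} eq =
    contradiction (sym eq) (<⇒≢ (<-≤-trans (spoke-place-< y) (m≤m+n N (path-place x))))
  ψ′-injective {inj₂ x} {inj₂ y} eq =
    cong inj₂ (place-injective s k toℕ-injective toℕ-injective (+-cancelˡ-≡ N _ _ eq))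

  ψ-injective : Injective _≡_ _≡_ ψ
  ψ-injective {x} {y} eq = begin
    x                 ≡⟨ sym (unsplit-split x) ⟩
    unsplit (split x) ≡⟨ cong unsplit (ψ′-injective eq) ⟩
    unsplit (split y) ≡⟨ unsplit-split y ⟩
    y                 ∎
    where open ≡-Reasoning

  ψ′-< : ∀ x → ψ′ x < N + (m * n-1 + s)
  ψ′-< (inj₁ x) = <-≤-trans (spoke-place-< x) (m≤m+n N _)
  ψ′-< (inj₂ x) = +-monoʳ-< N (place-< s k toℕ≤pred[n] toℕ<n x)

  ψ-< : ∀ e → ψ e < ∣E∣
  ψ-< e = <-≤-trans (ψ′-< (split e)) (≤-reflexive (count s k n-1))
    where
    count : ∀ s k n-1 → (s + k) * suc n-1 + s + ((s + k) * n-1 + s) ≡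
                        s * (suc (suc n-1) + suc n-1) + k * (suc n-1 + n-1)
    count = solve-∀

  -- Both ends of an edge lie in one column, which reduces triangles of the whole graph to those in
  -- `Triangles`.
  link : ∀ e → let x , y = ends e in col y ≡ col x × Link (col x) (row x) (row y) (ψ e)
  link (inj₁ (i , inj₁ p)) = refl , spoke (toℕ p)
  link (inj₁ (i , inj₂ p)) rewrite toℕ-inject₁ p = refl , path (toℕ p)
  link (inj₂ (i , inj₁ p)) = refl , spoke (toℕ p)
  link (inj₂ (i , inj₂ p)) rewrite toℕ-inject₁ p = refl , path (toℕ p)

  joined : ∀ e {x y} → ends e ≈ (x , y) → col y ≡ col x × Joined (col x) (row x) (row y) (ψ e)
  joined e (inj₁ refl) with c , l ← link e = c , inj₁ l
  joined e (inj₂ refl) with c , l ← link e =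
    -- The link is indexed by the column of the end listed first, which here is `y`.
    sym c , inj₂ (subst (λ j → Link j (row (proj₁ (ends e))) (row (proj₂ (ends e))) (ψ e))
                        (sym c) l)

  triangle-sum : (f : Embedding (C 3 ≤-refl) G) → let open Embedding f in
    φ (onV zero) + (φ (onV (suc zero)) + φ (onV (suc (suc zero)))) + (N + m * q) ≡
    ψ (onE (inj₁ zero)) + (ψ (onE (inj₁ (suc zero))) + ψ (onE (inj₂ tt))) + 3 * m
  triangle-sum f
    with ab , e₁ ← joined _ (Embedding.preserves-ends f (inj₁ zero))
       | bc , e₂ ← joined _ (Embedding.preserves-ends f (inj₁ (suc zero)))
       | ca , e₃ ← joined _ (Embedding.preserves-ends f (inj₂ tt))
    -- All three vertices are moved to the column of the first one.
    rewrite bc | ab = Balanced.sums (balanced _ _ _ e₁ e₂ e₃)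

  -- For any triangle the subtraction is exact: `total` expresses the minuend as the weight plus
  -- `N + m * q`.
  magic-constant : ℕ
  magic-constant = 3 + 3 * (∣V∣ + ∣E∣) + 3 * m ∸ (N + m * q)

  magic : (ℓ : Labeling G) →
          (∀ v → label G ℓ (inj₁ v) ≡ suc (φ v)) → (∀ e → label G ℓ (inj₂ e) + ψ e ≡ ∣V∣ + ∣E∣) →
          (S : SubgraphIsoTo (C 3 ≤-refl) G) → weight G ℓ (proj₁ S) ≡ magic-constant
  magic ℓ label-V label-E S = begin
    weight G ℓ (proj₁ S)                             ≡⟨ sym (m+n∸n≡m _ (N + m * q)) ⟩
    weight G ℓ (proj₁ S) + (N + m * q) ∸ (N + m * q) ≡⟨ cong (_∸ (N + m * q)) total ⟩
    magic-constant                                   ∎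
    where
    open ≡-Reasoning
    open Embedding (fromSubgraph {C 3 ≤-refl} {G} S)

    ℓᴱ = label G ℓ ∘ inj₂
    v₀ = onV zero
    v₁ = onV (suc zero)
    v₂ = onV (suc (suc zero))
    e₀ = onE (inj₁ zero)
    e₁ = onE (inj₁ (suc zero))
    e₂ = onE (inj₂ tt)

    total : weight G ℓ (proj₁ S) + (N + m * q) ≡ 3 + 3 * (∣V∣ + ∣E∣) + 3 * m
    total = balance-labels (ℓᴱ e₀) (ℓᴱ e₁) (ℓᴱ e₂) (ψ e₀) (ψ e₁) (ψ e₂)
      (weight-embedding {C 3 ≤-refl} {G} ℓ S)
      (label-V v₀) (label-V v₁) (label-V v₂) (label-E e₀) (label-E e₁) (label-E e₂)
      (triangle-sum (fromSubgraph S))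

  supermagic-labeling : ∃ λ (ℓ : Labeling G) → IsMagic G ℓ (C 3 ≤-refl) × VerticesFirst G ℓ
  supermagic-labeling =
    let ℓ , label-V , label-E , vertices-first =
          labeling G φ (place-injective s k rowᶠ-injective rowᶠ-injective) φ-< ψ ψ-injective ψ-<
    in ℓ , (magic-constant , magic ℓ label-V label-E) , vertices-first

theorem9 : ∀ (s k n : ℕ) → 1 ≤ s → 1 ≤ k → 3 ≤ n →
    Supermagic (C 3 ≤-refl) (s · F (suc n) ∪ k · F n)
theorem9 s k (suc (suc n)) _ _ (s≤s (s≤s _)) =
  -- Here `n` is two less than the number of path vertices of the shorter fans, in keeping with the
  -- two path vertices built into `fan-covered`.
  covered⇒covering (lift-∪ (lift-copies s (fan-covered (suc n))) (lift-copies k (fan-covered n))) ,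
  supermagic-labeling s k (suc n) (spokeOrder (suc (suc n)))
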